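{- For every Turing machine $\mathcal M$, the language $L^\omega(\mathcal M)=\bigcap_{n>0}L^n(\mathcal M)$ is in the class $\Pi^0_1$ (co-computably enumerable).
   Context: A Turing machine over finite alphabet $\Sigma$ (blank $B$) is $(Q,q_0,F,R,\Gamma)$ with finite state set $Q$, initial state $q_0$, disjoint accepting set $F$ and rejecting set $R$ (closed under transitions: from $F$ one stays in $F$, from $R$ in $R$), and transitions $(q,a)\to(q',b,\delta)$, $\delta\in\{ -1,0,1\}$, acting on a bi-infinite tape. A word is accepted if from the initial configuration on $w$ a state in $F$ is reached. For an integer $n>0$, the time $n$-perturbed version of $\mathcal M$ is the nondeterministic machine that behaves exactly as $\mathcal M$ except that after a time greater than $n$, from any configuration whose state $q\notin F\cup R$, it may change its control state to any $q'\in Q$ (tape and head unchanged). $L^n(\mathcal M)$ is the set of words accepted by some run of the time $n$-perturbed version of $\mathcal M$. -}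

module Defs where

open import Data.Nat using (ℕ; zero; suc; _<_)
open import Data.Fin using (Fin)
open import Data.Integer as ℤ using (ℤ; +_; -[1+_])
open import Data.Bool using (Bool; true; false; if_then_else_)
open import Data.Maybe using (Maybe; just; nothing)
open import Data.List using (List; length; lookup)
open import Data.Product using (Σ; _×_; _,_)
open import Data.Sum using (_⊎_)
open import Relation.Binary.PropositionalEquality using (_≡_)
open import Relation.Nullary using (does)

data Move : Set where
  left stay right : Move

moveℤ : Move → ℤ
moveℤ left  = -[1+ 0 ]
moveℤ stay  = + 0
moveℤ right = + 1

-- Tape alphabet Σ = Fin (suc k): the symbol 'Fin.zero' is the blank B,
-- input words are over the non-blank symbols Fin k (embedded by Fin.suc).
Sym : ℕ → Set
Sym k = Fin (suc k)

blank : ∀ {k} → Sym k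
blank = Fin.zero

record TM (k : ℕ) : Set where
  field
    nQ    : ℕ
    q₀    : Fin nQ
    isF   : Fin nQ → Bool
    isR   : Fin nQ → Bool
    δ     : Fin nQ → Sym k → Maybe (Fin nQ × Sym k × Move)
    disjoint : ∀ q → isF q ≡ true → isR q ≡ false
    F-closed : ∀ q a q' b d → isF q ≡ true → δ q a ≡ just (q' , b , d) → isF q' ≡ true
    R-closed : ∀ q a q' b d → isR q ≡ true → δ q a ≡ just (q' , b , d) → isR q' ≡ true

module _ {k : ℕ} (M : TM k) where
  open TM M

  record Config : Set where
    constructor ⟨_,_,_⟩
    field
      state : Fin nQ
      tape  : ℤ → Sym k
      head  : ℤ

  write : (ℤ → Sym k) → ℤ → Sym k → (ℤ → Sym k)
  write T h b i = if does (i ℤ.≟ h) then b else T i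

  initTape : List (Fin k) → ℤ → Sym k
  initTape w (+ i) with i Data.Nat.<? length w
  ... | Relation.Nullary.yes p = Fin.suc (lookup w (Data.Fin.fromℕ< p))
  ... | Relation.Nullary.no _  = blank
  initTape w -[1+ _ ] = blank

  initConfig : List (Fin k) → Config
  initConfig w = ⟨ q₀ , initTape w , + 0 ⟩

  data PStep (n : ℕ) (t : ℕ) : Config → Config → Set where
    det  : ∀ {q T h q' b d} → δ q (T h) ≡ just (q' , b , d) →
           PStep n t ⟨ q , T , h ⟩ ⟨ q' , write T h b , h ℤ.+ moveℤ d ⟩
    pert : ∀ {q T h} (q' : Fin nQ) → n < t → isF q ≡ false → isR q ≡ false →
           PStep n t ⟨ q , T , h ⟩ ⟨ q' , T , h ⟩

  data PAccepts (n : ℕ) : ℕ → Config → Set where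
    here : ∀ {t c} → isF (Config.state c) ≡ true → PAccepts n t c
    step : ∀ {t c c'} → PStep n t c c' → PAccepts n (suc t) c' → PAccepts n t c

  Lⁿ : ℕ → List (Fin k) → Set
  Lⁿ n w = PAccepts n 0 (initConfig w)

  Lω : List (Fin k) → Set
  Lω w = ∀ n → 0 < n → Lⁿ n w

-- Π⁰₁ (co-c.e.) language: there is a computable (= Agda-definable, total)
-- Boolean predicate f with  w ∈ L  ⇔  ∀ m, f w m = true.
Π⁰₁ : ∀ {k} → (List (Fin k) → Set) → Set
Π⁰₁ {k} L = Σ (List (Fin k) → ℕ → Bool) λ f →
  ∀ w → (L w → ∀ m → f w m ≡ true) × ((∀ m → f w m ≡ true) → L w)

module Submission where

open import Data.Nat using (ℕ; zero; suc; _+_; _<_; s≤s; z≤n)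
open import Data.Nat.Properties using (+-suc; +-identityʳ; m+n≮n; n<1+n)
open import Data.Fin using (Fin)
open import Data.Fin.Properties using (any?)
open import Data.Bool using (Bool; true; false; _∨_; _∧_; not)
open import Data.Bool.Properties using (_≟_; ∨-zeroʳ)
open import Data.List using (List)
open import Data.Maybe using (just; nothing)
open import Data.Product using (_,_; ∃)
open import Data.Empty using (⊥-elim)
open import Function.Bundles using (_⇔_; mk⇔; Equivalence)
open import Relation.Nullary using (Dec; does; yes; no; ¬_; contradiction)
open import Relation.Binary.PropositionalEquality using (_≡_; refl; sym; trans)
open import Data.Integer as ℤ using ()
open import Defs

-- Each Lⁿ is decidable, uniformly in n: before time n+1 the perturbed machine
-- runs deterministically, and from time n+1 on it accepts from a configuration
-- exactly when its state is accepting, or it is not rejecting and some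
-- accepting state exists (jump there). An intersection of uniformly decidable
-- languages is co-c.e.

Π⁰₁-⋂ : ∀ {k} (L : ℕ → List (Fin k) → Set) (decide : ℕ → List (Fin k) → Bool) →
        (∀ n w → L n w ⇔ decide n w ≡ true) →
        Π⁰₁ (λ w → ∀ n → 0 < n → L n w)
Π⁰₁-⋂ L decide L⇔ = (λ w m → decide (suc m) w) , λ w →
  (λ Lw m → Equivalence.to (L⇔ (suc m) w) (Lw (suc m) (s≤s z≤n))) ,
  λ { d (suc m) _ → Equivalence.from (L⇔ (suc m) w) (d m) }

module _ {k : ℕ} (M : TM k) where
  open TM M

  hasAccepting? : Dec (∃ λ q → isF q ≡ true)
  hasAccepting? = any? (λ q → isF q ≟ true)

  hasAccepting : Bool
  hasAccepting = does hasAccepting?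

  hasAccepting-complete : (∃ λ q → isF q ≡ true) → hasAccepting ≡ true
  hasAccepting-complete ex with hasAccepting?
  ... | yes _ = refl
  ... | no ¬ex = contradiction ex ¬ex

  acceptsLate : Config M → Bool
  acceptsLate ⟨ q , _ , _ ⟩ = isF q ∨ (not (isR q) ∧ hasAccepting)

  simulate : ℕ → Config M → Bool
  simulate zero c = acceptsLate c
  simulate (suc r) ⟨ q , T , h ⟩ with δ q (T h)
  ... | nothing = isF q
  ... | just (q' , b , d) = isF q ∨ simulate r ⟨ q' , write M T h b , h ℤ.+ moveℤ d ⟩

  module _ {n : ℕ} where

    PAccepts⇒hasAccepting : ∀ {t c} → PAccepts M n t c → ∃ λ q → isF q ≡ true
    PAccepts⇒hasAccepting (here acc) = _ , acc
    PAccepts⇒hasAccepting (step _ rest) = PAccepts⇒hasAccepting rest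

    PAccepts⇒¬rejecting : ∀ {t c} → PAccepts M n t c → isR (Config.state c) ≡ false
    PAccepts⇒¬rejecting (here acc) = disjoint _ acc
    PAccepts⇒¬rejecting {c = ⟨ q , T , h ⟩} (step (det {q' = q'} {b} {d} eδ) rest)
      with isR q in eR
    ... | false = refl
    ... | true with trans (sym (R-closed q (T h) q' b d eR eδ)) (PAccepts⇒¬rejecting rest)
    ... | ()
    PAccepts⇒¬rejecting (step (pert _ _ _ ¬R) _) = ¬R

    PAccepts⇒acceptsLate : ∀ {t} c → PAccepts M n t c → acceptsLate c ≡ true
    PAccepts⇒acceptsLate ⟨ q , T , h ⟩ acc with isF q
    ... | true = refl
    ... | false rewrite PAccepts⇒¬rejecting acc
                      | hasAccepting-complete (PAccepts⇒hasAccepting acc) = refl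

    acceptsLate⇒PAccepts : ∀ {t} c → n < t → acceptsLate c ≡ true → PAccepts M n t c
    acceptsLate⇒PAccepts ⟨ q , T , h ⟩ n<t _
      with isF q in eF | isR q in eR | hasAccepting?
    ... | true  | _     | _            = here eF
    ... | false | false | yes (qF , F) = step (pert qF n<t eF eR) (here F)
    acceptsLate⇒PAccepts _ _ () | false | true  | _
    acceptsLate⇒PAccepts _ _ () | false | false | no _

    PAccepts⇒simulate : ∀ r {t} c → r + t ≡ suc n → PAccepts M n t c → simulate r c ≡ true
    PAccepts⇒simulate zero c _ acc = PAccepts⇒acceptsLate c acc
    PAccepts⇒simulate (suc r) ⟨ q , T , h ⟩ _ (here F) with δ q (T h)
    ... | nothing = F
    ... | just _ rewrite F = refl
    PAccepts⇒simulate (suc r) {t} ⟨ q , T , h ⟩ r+t≡ (step (det eδ) rest)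
      rewrite eδ | PAccepts⇒simulate r _ (trans (+-suc r t) r+t≡) rest = ∨-zeroʳ (isF q)
    PAccepts⇒simulate (suc r) {t} _ r+t≡ (step (pert _ n<t _ _) _) =
      ⊥-elim (perturbation-too-early r t r+t≡ n<t)
      where
      perturbation-too-early : ∀ r t → suc r + t ≡ suc n → ¬ n < t
      perturbation-too-early r t refl = m+n≮n r t

    simulate⇒PAccepts : ∀ r {t} c → r + t ≡ suc n → simulate r c ≡ true → PAccepts M n t c
    simulate⇒PAccepts zero c refl sim = acceptsLate⇒PAccepts c (n<1+n n) sim
    simulate⇒PAccepts (suc r) {t} ⟨ q , T , h ⟩ r+t≡ sim with δ q (T h) in eδ
    ... | nothing = here sim
    ... | just _ with isF q in eF
    ...   | true  = here eF
    ...   | false = step (det eδ) (simulate⇒PAccepts r _ (trans (+-suc r t) r+t≡) sim)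

  Lⁿ⇔simulate : ∀ n w → Lⁿ M n w ⇔ simulate (suc n) (initConfig M w) ≡ true
  Lⁿ⇔simulate n w = mk⇔ (PAccepts⇒simulate (suc n) _ time)
                        (simulate⇒PAccepts (suc n) _ time)
    where
    time : suc n + 0 ≡ suc n
    time = +-identityʳ (suc n)

theorem54 : ∀ (k : ℕ) (M : TM k) → Π⁰₁ (Lω M)
theorem54 k M = Π⁰₁-⋂ (Lⁿ M) (λ n w → simulate M (suc n) (initConfig M w)) (Lⁿ⇔simulate M)
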